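{- For every integer $k\geq 0$, the formal power series $G_k(x)$ satisfies $$G_k(x)=\frac{1+x\sum_{j=0}^{k-1}C(k,j)\bigl(4^{j}+(-1)^{k}(-4)^{j}\bigr)G_j(x)}{1-2^{k}(2^{k+1}+1)x},$$ where $C(k,j)=\binom{k}{j}$ (for $k=0$ this reads $G_0(x)=1/(1-3x)$).
   Context: The Stern polynomials $B_n(t)\in\mathbb{Z}[t]$ are defined by $B_0(t)=0$, $B_1(t)=1$, and for $n\geq 1$: $B_{2n}(t)=tB_n(t)$, $B_{2n+1}(t)=B_n(t)+B_{n+1}(t)$. For $n\geq1$ let $e(n)=\deg B_n(t)$. For each $n\ge0$ the set $\{a\geq1:\;e(a)=n\}$ is finite (it has $3^n$ elements). For $k,n\geq 0$ let $S_k(n)=\sum_{a\geq 1:\;e(a)=n}a^{k}$ and define the formal power series $G_k(x)=\sum_{a=1}^{\infty}a^{k}x^{e(a)}=\sum_{n=0}^{\infty}S_k(n)x^n$. -}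

module Defs where

open import Algebra.Properties.Semiring.Sum as SemiringSum using ()
open import Data.Fin.Base as Fin using (Fin; toℕ)
open import Data.Integer.Base as ℤ using (ℤ; +_; 0ℤ; 1ℤ; +0; +[1+_])
import Data.Integer.Properties as ℤ
open import Data.List.Base using (List; []; _∷_; filter; map; upTo)
open import Data.Nat.ListAction using (sum)
open import Data.List.Membership.Propositional using (_∈_)
open import Data.List.Membership.Propositional.Properties using (∈-filter⁺; ∈-filter⁻; ∈-map⁺; ∈-map⁻; ∈-upTo⁺)
open import Data.List.Relation.Unary.All using (All; []; _∷_)
open import Data.List.Relation.Unary.Unique.Propositional using (Unique)
import Data.List.Relation.Unary.Unique.Propositional.Properties as Unique
open import Data.Maybe.Base as Maybe using (Maybe; just; nothing)
import Data.Maybe.Properties as Maybe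
open import Data.Nat.Base as ℕ using (ℕ; zero; suc; _≤_; _<_; z≤n; s≤s; z<s; ⌊_/2⌋; ⌈_/2⌉; parity)
open import Data.Nat.Induction using (<-wellFounded; Acc; acc; <-rec)
import Data.Nat.Properties as ℕ
open import Data.Nat.Tactic.RingSolver using (solve-∀)
open import Data.Parity.Base using (Parity; 0ℙ; 1ℙ)
open import Data.Product.Base using (∃; _×_; _,_)
open import Data.Vec.Base as Vec using (Vec; []; _∷_)
open import Relation.Binary.PropositionalEquality
open import Relation.Nullary.Decidable.Core using (yes; no)
open import Relation.Unary using (Decidable)

-- c₀ ∷ c₁ ∷ … is c₀ + c₁ t + …; trailing zeros are allowed.
Poly : Set
Poly = List ℤ

infixl 6 _+ᵖ_

_+ᵖ_ : Poly → Poly → Poly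
[]      +ᵖ q       = q
p       +ᵖ []      = p
(a ∷ p) +ᵖ (b ∷ q) = (a ℤ.+ b) ∷ (p +ᵖ q)

t·_ : Poly → Poly
t· p = 0ℤ ∷ p

-- The zero polynomial has no degree.
deg : Poly → Maybe ℕ
deg []      = nothing
deg (c ∷ p) with deg p | c ℤ.≟ 0ℤ
... | just d  | _     = just (suc d)
... | nothing | yes _ = nothing
... | nothing | no  _ = just 0

private
  step : Parity → Poly → Poly → Poly
  step 0ℙ p q = t· p
  step 1ℙ p q = p +ᵖ q

  sternAcc : ∀ n → Acc _<_ n → Poly
  sternAcc 0               _        = []
  sternAcc 1               _        = 1ℤ ∷ []
  sternAcc n@(suc (suc m)) (acc rs) =
    step (parity n) (sternAcc ⌊ n /2⌋ (rs (ℕ.⌊n/2⌋<n (suc m))))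
                    (sternAcc ⌈ n /2⌉ (rs (ℕ.⌈n/2⌉<n m)))

-- Characterised by B-0, B-1, B-even and B-odd below.
B : ℕ → Poly
B n = sternAcc n (<-wellFounded n)

private
  sternAcc-irr : ∀ n (p q : Acc _<_ n) → sternAcc n p ≡ sternAcc n q
  sternAcc-irr 0               _        _        = refl
  sternAcc-irr 1               _        _        = refl
  sternAcc-irr n@(suc (suc m)) (acc rs) (acc ss) =
    cong₂ (step (parity n)) (sternAcc-irr ⌊ n /2⌋ _ _) (sternAcc-irr ⌈ n /2⌉ _ _)

  B-unfold : ∀ m → B (2 ℕ.+ m) ≡ step (parity m) (B (suc ⌊ m /2⌋)) (B (suc ⌈ m /2⌉))
  B-unfold m with <-wellFounded (2 ℕ.+ m)
  ... | acc rs = cong₂ (step (parity m)) (sternAcc-irr (suc ⌊ m /2⌋) _ _) (sternAcc-irr (suc ⌈ m /2⌉) _ _)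

  parity-even : ∀ m → parity (m ℕ.+ m) ≡ 0ℙ
  parity-even zero    = refl
  parity-even (suc m) rewrite ℕ.+-suc m m = parity-even m

  parity-odd : ∀ m → parity (suc (m ℕ.+ m)) ≡ 1ℙ
  parity-odd zero    = refl
  parity-odd (suc m) rewrite ℕ.+-suc m m = parity-odd m

B-0 : B 0 ≡ []
B-0 = refl

B-1 : B 1 ≡ 1ℤ ∷ []
B-1 = refl

B-even : ∀ n → 1 ≤ n → B (2 ℕ.* n) ≡ t· B n
B-even (suc m) _
  rewrite ℕ.+-identityʳ m | ℕ.+-suc m m | B-unfold (m ℕ.+ m)
        | parity-even m | sym (ℕ.n≡⌊n+n/2⌋ m)
  = refl

B-odd : ∀ n → 1 ≤ n → B (2 ℕ.* n ℕ.+ 1) ≡ B n +ᵖ B (n ℕ.+ 1)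
B-odd (suc m) _
  rewrite ℕ.+-comm (2 ℕ.* suc m) 1 | ℕ.+-comm m 1
        | ℕ.+-identityʳ m | ℕ.+-suc m m | B-unfold (suc (m ℕ.+ m))
        | parity-odd m | sym (ℕ.n≡⌈n+n/2⌉ m) | sym (ℕ.n≡⌊n+n/2⌋ m)
  = refl

e : ℕ → Maybe ℕ
e n = deg (B n)

-- The largest a with e(a) = n, i.e. (4ⁿ⁺¹ − 1)/3.
bound : ℕ → ℕ
bound zero    = 1
bound (suc n) = suc (4 ℕ.* bound n)

hasDegree? : ∀ n → Decidable (λ a → e a ≡ just n)
hasDegree? n a = Maybe.≡-dec ℕ._≟_ (e a) (just n)

-- By fibre-complete, cutting the search off at bound n loses nothing.
fibre : ℕ → List ℕ
fibre n = filter (hasDegree? n) (map suc (upTo (bound n)))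

NonNeg : Poly → Set
NonNeg = All (0ℤ ℤ.≤_)

+ᵖ-nonNeg : ∀ {p q} → NonNeg p → NonNeg q → NonNeg (p +ᵖ q)
+ᵖ-nonNeg []       qs       = qs
+ᵖ-nonNeg (x ∷ ps) []       = x ∷ ps
+ᵖ-nonNeg (x ∷ ps) (y ∷ qs) = ℤ.+-mono-≤ x y ∷ +ᵖ-nonNeg ps qs

sternAcc-nonNeg : ∀ n (p : Acc _<_ n) → NonNeg (sternAcc n p)
sternAcc-nonNeg 0               _        = []
sternAcc-nonNeg 1               _        = ℤ.+≤+ z≤n ∷ []
sternAcc-nonNeg n@(suc (suc m)) (acc rs) with parity m
... | 0ℙ = ℤ.≤-refl ∷ sternAcc-nonNeg ⌊ n /2⌋ _
... | 1ℙ = +ᵖ-nonNeg (sternAcc-nonNeg ⌊ n /2⌋ _) (sternAcc-nonNeg ⌈ n /2⌉ _)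

B-nonNeg : ∀ n → NonNeg (B n)
B-nonNeg n = sternAcc-nonNeg n (<-wellFounded n)

deg-t· : ∀ p {d} → deg p ≡ just d → deg (t· p) ≡ just (suc d)
deg-t· p eq with deg p
deg-t· p refl | just _ = refl

DegAtLeast : ℕ → Poly → Set
DegAtLeast d p = ∃ λ d′ → deg p ≡ just d′ × d ≤ d′

atLeast-∷ : ∀ {d} c p → DegAtLeast d p → DegAtLeast (suc d) (c ∷ p)
atLeast-∷ c p (d′ , eq , le) with deg p
atLeast-∷ c p (d′ , refl , le) | just _ = suc d′ , refl , s≤s le

atLeast-0 : ∀ c p → c ≢ 0ℤ → DegAtLeast 0 (c ∷ p)
atLeast-0 c p c≢0 with deg p | c ℤ.≟ 0ℤ
... | just d  | _      = suc d , refl , z≤n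
... | nothing | yes c≡0 with () ← c≢0 c≡0
... | nothing | no  _  = 0 , refl , z≤n

≢0-+ : ∀ {a b} → 0ℤ ℤ.≤ a → 0ℤ ℤ.≤ b → a ≢ 0ℤ → a ℤ.+ b ≢ 0ℤ
≢0-+ {+0}       _ _ a≢0 _ = a≢0 refl
≢0-+ {+[1+ _ ]} {+ _} _ _ _ ()

deg-+ᵖ : ∀ {p q d} → NonNeg p → NonNeg q → deg p ≡ just d → DegAtLeast d (p +ᵖ q)
deg-+ᵖ {p = _ ∷ _} (_ ∷ _) [] eq = _ , eq , ℕ.≤-refl
deg-+ᵖ {p = a ∷ p} {b ∷ q} (x ∷ ps) (y ∷ qs) eq with deg p in eqp | a ℤ.≟ 0ℤ
deg-+ᵖ {p = a ∷ p} {b ∷ q} (x ∷ ps) (y ∷ qs) refl | just d  | _ =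
  atLeast-∷ (a ℤ.+ b) (p +ᵖ q) (deg-+ᵖ ps qs eqp)
deg-+ᵖ {p = a ∷ p} {b ∷ q} (x ∷ ps) (y ∷ qs) refl | nothing | no a≢0 =
  atLeast-0 (a ℤ.+ b) (p +ᵖ q) (≢0-+ x y a≢0)

+ᵖ-comm : ∀ p q → p +ᵖ q ≡ q +ᵖ p
+ᵖ-comm []      []      = refl
+ᵖ-comm []      (_ ∷ _) = refl
+ᵖ-comm (_ ∷ _) []      = refl
+ᵖ-comm (a ∷ p) (b ∷ q) = cong₂ _∷_ (ℤ.+-comm a b) (+ᵖ-comm p q)

data Mod4 : ℕ → Set where
  0mod4 : ∀ m → Mod4 (0 ℕ.+ m ℕ.* 4)
  1mod4 : ∀ m → Mod4 (1 ℕ.+ m ℕ.* 4)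
  2mod4 : ∀ m → Mod4 (2 ℕ.+ m ℕ.* 4)
  3mod4 : ∀ m → Mod4 (3 ℕ.+ m ℕ.* 4)

mod4 : ∀ n → Mod4 n
mod4 0 = 0mod4 0
mod4 1 = 1mod4 0
mod4 2 = 2mod4 0
mod4 3 = 3mod4 0
mod4 (suc (suc (suc (suc n)))) with mod4 n
... | 0mod4 m = 0mod4 (suc m)
... | 1mod4 m = 1mod4 (suc m)
... | 2mod4 m = 2mod4 (suc m)
... | 3mod4 m = 3mod4 (suc m)

bound-mono : ∀ {m n} → m ≤ n → bound m ≤ bound n
bound-mono {n = zero}  z≤n     = ℕ.≤-refl
bound-mono {n = suc n} z≤n     = s≤s z≤n
bound-mono             (s≤s p) = s≤s (ℕ.*-monoʳ-≤ 4 (bound-mono p))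

Bounded : ℕ → Set
Bounded a = ∃ λ d → e a ≡ just d × a ≤ bound d

bounded-2m : ∀ m → 1 ≤ m → Bounded m → Bounded (2 ℕ.* m)
bounded-2m m 1≤m (d , eq , le) =
  suc d , trans (cong deg (B-even m 1≤m)) (deg-t· (B m) eq) ,
  ℕ.≤-trans (ℕ.*-mono-≤ {2} {4} (s≤s (s≤s z≤n)) le) (ℕ.n≤1+n _)

bounded-4m+1 : ∀ m → 1 ≤ m → Bounded m → Bounded (1 ℕ.+ m ℕ.* 4)
bounded-4m+1 m 1≤m (d , eq , le) with
  deg-+ᵖ {q = B (2 ℕ.* m ℕ.+ 1)} (B-nonNeg (2 ℕ.* m)) (B-nonNeg (2 ℕ.* m ℕ.+ 1))
    (trans (cong deg (B-even m 1≤m)) (deg-t· (B m) eq))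
... | d′ , eq′ , le′ =
  d′ , trans (cong deg (trans (cong B (lem m)) (B-odd (2 ℕ.* m) (ℕ.≤-trans 1≤m (ℕ.m≤m+n m _))))) eq′ ,
  ℕ.≤-trans (s≤s (subst (_≤ 4 ℕ.* bound d) (ℕ.*-comm 4 m) (ℕ.*-monoʳ-≤ 4 le))) (bound-mono le′)
  where
  lem : ∀ m → 1 ℕ.+ m ℕ.* 4 ≡ 2 ℕ.* (2 ℕ.* m) ℕ.+ 1
  lem = solve-∀

bounded-4m+3 : ∀ m → Bounded (suc m) → Bounded (3 ℕ.+ m ℕ.* 4)
bounded-4m+3 m (d , eq , le) with
  deg-+ᵖ {q = B (2 ℕ.* m ℕ.+ 1)} (B-nonNeg (2 ℕ.* suc m)) (B-nonNeg (2 ℕ.* m ℕ.+ 1))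
    (trans (cong deg (B-even (suc m) z<s)) (deg-t· (B (suc m)) eq))
... | d′ , eq′ , le′ =
  d′ , trans (cong deg B-4m+3) eq′ ,
  ℕ.≤-trans (ℕ.n≤1+n _)
    (ℕ.≤-trans (subst (_≤ 4 ℕ.* bound d) (ℕ.*-comm 4 (suc m)) (ℕ.*-monoʳ-≤ 4 le))
               (ℕ.≤-trans (ℕ.n≤1+n _) (bound-mono le′)))
  where
  lem₁ : ∀ m → 3 ℕ.+ m ℕ.* 4 ≡ 2 ℕ.* (2 ℕ.* m ℕ.+ 1) ℕ.+ 1
  lem₁ = solve-∀
  lem₂ : ∀ m → 2 ℕ.* m ℕ.+ 1 ℕ.+ 1 ≡ 2 ℕ.* suc m
  lem₂ = solve-∀
  B-4m+3 : B (3 ℕ.+ m ℕ.* 4) ≡ B (2 ℕ.* suc m) +ᵖ B (2 ℕ.* m ℕ.+ 1)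
  B-4m+3 = trans (cong B (lem₁ m)) (trans (B-odd (2 ℕ.* m ℕ.+ 1) (ℕ.m≤n+m 1 _))
    (trans (cong (λ i → B (2 ℕ.* m ℕ.+ 1) +ᵖ B i) (lem₂ m)) (+ᵖ-comm (B (2 ℕ.* m ℕ.+ 1)) _)))

bounded : ∀ a → 1 ≤ a → Bounded a
bounded = <-rec _ go
  where
  go : ∀ a → (∀ {b} → b < a → 1 ≤ b → Bounded b) → 1 ≤ a → Bounded a
  go a rec 1≤a with mod4 a
  ... | 0mod4 (suc m) = subst Bounded (lem m)
        (bounded-2m (2 ℕ.* suc m) z<s (rec (subst (2 ℕ.* suc m <_) (lem m) (ℕ.m<m+n _ z<s)) z<s))
    where
    lem : ∀ m → 2 ℕ.* (2 ℕ.* suc m) ≡ suc m ℕ.* 4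
    lem = solve-∀
  ... | 1mod4 zero    = 0 , refl , ℕ.≤-refl
  ... | 1mod4 (suc m) = bounded-4m+1 (suc m) z<s (rec (s≤s (ℕ.m≤m*n (suc m) 4)) z<s)
  ... | 2mod4 m       = subst Bounded (lem m)
        (bounded-2m (suc (2 ℕ.* m)) z<s (rec (subst (suc (2 ℕ.* m) <_) (lem m) (ℕ.m<m+n _ z<s)) z<s))
    where
    lem : ∀ m → 2 ℕ.* suc (2 ℕ.* m) ≡ 2 ℕ.+ m ℕ.* 4
    lem = solve-∀
  ... | 3mod4 m       = bounded-4m+3 m (rec (s≤s (s≤s (ℕ.m≤n⇒m≤1+n (ℕ.m≤m*n m 4)))) z<s)

e-defined : ∀ a → 1 ≤ a → ∃ λ d → e a ≡ just d
e-defined a 1≤a with d , eq , _ ← bounded a 1≤a = d , eq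

fibre-complete : ∀ {n a} → 1 ≤ a → e a ≡ just n → a ∈ fibre n
fibre-complete {n} {a@(suc _)} 1≤a eq with bounded a 1≤a
... | d , eq′ , le with refl ← Maybe.just-injective (trans (sym eq′) eq) =
  ∈-filter⁺ (hasDegree? n) (∈-map⁺ suc (∈-upTo⁺ le)) eq

fibre-sound : ∀ {n a} → a ∈ fibre n → 1 ≤ a × e a ≡ just n
fibre-sound {n} a∈ with ∈-filter⁻ (hasDegree? n) {xs = map suc (upTo (bound n))} a∈
... | a∈′ , eq with _ , _ , refl ← ∈-map⁻ suc a∈′ = z<s , eq

fibre-unique : ∀ n → Unique (fibre n)
fibre-unique n = Unique.filter⁺ (hasDegree? n) (Unique.map⁺ ℕ.suc-injective (Unique.upTo⁺ (bound n)))

open SemiringSum ℤ.+-*-semiring public using (sum-syntax; sum⁺-syntax)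

FPS : Set
FPS = ℕ → ℤ

infix  4 _≈ˢ_
infixl 6 _+ˢ_ _-ˢ_
infixl 7 _*ˢ_ _/ˢ_∵_

_≈ˢ_ : FPS → FPS → Set
f ≈ˢ g = ∀ n → f n ≡ g n

constˢ : ℤ → FPS
constˢ c zero    = c
constˢ c (suc _) = 0ℤ

1ˢ : FPS
1ˢ = constˢ 1ℤ

x : FPS
x 1 = 1ℤ
x _ = 0ℤ

_+ˢ_ : FPS → FPS → FPS
(f +ˢ g) n = f n ℤ.+ g n

_-ˢ_ : FPS → FPS → FPS
(f -ˢ g) n = f n ℤ.- g n

_*ˢ_ : FPS → FPS → FPS
(f *ˢ g) n = ∑[ i ≤ n ] (f (toℕ i) ℤ.* g (n ℕ.∸ toℕ i))

∑ˢ : ∀ k → (Fin k → FPS) → FPS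
∑ˢ k f n = ∑[ j < k ] f j n

syntax ∑ˢ k (λ j → f) = ∑ˢ[ j < k ] f

-- Coefficients n, n-1, …, 0 of 1/d, for d with constant term 1.
inverseCoeffs : FPS → ∀ n → Vec ℤ (suc n)
inverseCoeffs d zero    = 1ℤ ∷ []
inverseCoeffs d (suc n) = ℤ.- (∑[ i ≤ n ] (d (suc (toℕ i)) ℤ.* Vec.lookup cs i)) ∷ cs
  where cs = inverseCoeffs d n

-- The multiplicative inverse of d if d has constant term 1; see inverse-correct.
inverse : FPS → FPS
inverse d n = Vec.head (inverseCoeffs d n)

_/ˢ_∵_ : FPS → (d : FPS) → .(d 0 ≡ 1ℤ) → FPS
f /ˢ d ∵ _ = f *ˢ inverse d

private
  lookup-inverseCoeffs : ∀ d n (i : Fin (suc n)) →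
    Vec.lookup (inverseCoeffs d n) i ≡ inverse d (n ℕ.∸ toℕ i)
  lookup-inverseCoeffs d zero    Fin.zero    = refl
  lookup-inverseCoeffs d (suc n) Fin.zero    = refl
  lookup-inverseCoeffs d (suc n) (Fin.suc i) = lookup-inverseCoeffs d n i

inverse-correct : ∀ d → d 0 ≡ 1ℤ → d *ˢ inverse d ≈ˢ 1ˢ
inverse-correct d d₀ zero    rewrite d₀ = refl
inverse-correct d d₀ (suc n) = begin
  d 0 ℤ.* inverse d (suc n) ℤ.+ (∑[ i ≤ n ] (d (suc (toℕ i)) ℤ.* inverse d (n ℕ.∸ toℕ i)))
    ≡⟨ cong₂ ℤ._+_
         (trans (cong (ℤ._* inverse d (suc n)) d₀) (ℤ.*-identityˡ (inverse d (suc n))))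
         (SemiringSum.sum-cong-≗ ℤ.+-*-semiring
           (λ i → cong (d (suc (toℕ i)) ℤ.*_) (sym (lookup-inverseCoeffs d n i)))) ⟩
  ℤ.- s ℤ.+ s
    ≡⟨ ℤ.+-inverseˡ s ⟩
  0ℤ ∎
  where
  open ≡-Reasoning
  s = ∑[ i ≤ n ] (d (suc (toℕ i)) ℤ.* Vec.lookup (inverseCoeffs d n) i)

1-cx-constantTerm : ∀ c → (1ˢ -ˢ constˢ c *ˢ x) 0 ≡ 1ℤ
1-cx-constantTerm c rewrite ℤ.*-zeroʳ c = refl

S : ℕ → ℕ → ℕ
S k n = sum (map (ℕ._^ k) (fibre n))

G : ℕ → FPS
G k n = + S k n

{-# OPTIONS --safe #-}
module Submission where

-- The recursion gives e(2n) = e(n) + 1 and e(2n+1) = max(e(n), e(n+1)), since all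
-- coefficients are nonnegative. Hence e(n) and e(n+1) differ by at most 1, and therefore
-- e(4n ± 1) = e(n) + 1. As every a > 1 is uniquely 2m, 4m + 1 or 4m − 1 with m ≥ 1, the
-- fibre of e over n + 1 is the disjoint union of the images of the fibre over n under
-- these three maps, and the binomial theorem turns this into
--   S_k(n+1) = 2^k (2^(k+1) + 1) S_k(n) + Σ_{j<k} C(k,j) (4^j + (−1)^k (−4)^j) S_j(n).

open import Algebra.Properties.CommutativeMonoid.Sum using (∑-distrib-+)
import Algebra.Properties.CommutativeSemiring.Binomial as Binomial
import Algebra.Properties.CommutativeSemiring.Exp as Exp
import Algebra.Properties.Semiring.Mult as Mult
import Algebra.Properties.Semiring.Sum as SemiringSum
open import Data.Fin.Base using (Fin; toℕ)
open import Data.Fin.Properties using (toℕ-fromℕ; toℕ-inject₁; toℕ≤pred[n])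
open import Data.Integer.Base using (ℤ; +_; -_; _+_; _*_; _^_; 0ℤ; 1ℤ; +0; +[1+_]; -[1+_])
import Data.Integer.Properties as ℤ
import Data.Integer.Tactic.RingSolver as ℤ-Solver
open import Data.List.Base using (List; []; _∷_; _++_; map)
open import Data.List.Membership.Propositional using (_∈_)
open import Data.List.Membership.Propositional.Properties using (∈-map⁺; ∈-map⁻; ∈-++⁺ˡ; ∈-++⁺ʳ; ∈-++⁻)
open import Data.List.Membership.Propositional.Properties.WithK using (unique∧set⇒bag)
open import Data.List.Properties using (map-++)
open import Data.List.Relation.Binary.BagAndSetEquality using (∼bag⇒↭)
open import Data.List.Relation.Binary.Disjoint.Propositional using (Disjoint)
open import Data.List.Relation.Binary.Permutation.Propositional using (_↭_)
open import Data.List.Relation.Binary.Permutation.Propositional.Properties using (map⁺)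
open import Data.List.Relation.Unary.All using (All; []; _∷_; tabulate)
open import Data.List.Relation.Unary.Unique.Propositional using (Unique)
import Data.List.Relation.Unary.Unique.Propositional.Properties as Unique
open import Data.Maybe.Base using (just; nothing; maybe′)
open import Data.Nat.Base as ℕ using (ℕ; zero; suc; pred; _≤_; _<_; _⊔_; z≤n; s≤s; z<s)
open import Data.Nat.Combinatorics using (_C_; nCn≡1)
open import Data.Nat.Induction using (<-rec)
open import Data.Nat.ListAction using (sum)
open import Data.Nat.ListAction.Properties using (sum-++; sum-↭)
import Data.Nat.Properties as ℕ
open import Data.Nat.Tactic.RingSolver using (solve-∀)
open import Data.Product.Base using (_×_; _,_; proj₁; proj₂)
open import Data.Sum.Base using (inj₁; inj₂)
open import Function.Base using (_∘_)
open import Function.Bundles using (mk⇔)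
open import Relation.Binary.PropositionalEquality
open import Relation.Nullary.Decidable.Core using (yes; no)
open import Relation.Nullary.Negation.Core using (contradiction)
open import Defs

open ≡-Reasoning

open SemiringSum ℤ.+-*-semiring using (sum-cong-≗; sum-init-last; sum-replicate-zero; *-distribˡ-sum)

-- Degrees of Stern polynomials

-- One more than the degree, and 0 for the zero polynomial: with this convention the size of a sum
-- without cancellation is a plain maximum.
size : Poly → ℕ
size p = maybe′ suc 0 (deg p)

consSize : ℤ → ℕ → ℕ
consSize +0 zero    = 0
consSize _  zero    = 1
consSize _  (suc n) = suc (suc n)

size-∷ : ∀ c p → size (c ∷ p) ≡ consSize c (size p)
size-∷ c p with deg p | c ℤ.≟ 0ℤ
size-∷ +0        p | just _  | _        = refl
size-∷ +[1+ _ ]  p | just _  | _        = refl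
size-∷ -[1+ _ ]  p | just _  | _        = refl
size-∷ c         p | nothing | yes refl = refl
size-∷ +0        p | nothing | no c≢0   = contradiction refl c≢0
size-∷ +[1+ _ ]  p | nothing | no _     = refl
size-∷ -[1+ _ ]  p | nothing | no _     = refl

-- The split on `c` only unblocks reduction, as the first clause of `consSize` matches on `+0`.
consSize-suc : ∀ c n → consSize c (suc n) ≡ suc (suc n)
consSize-suc +0       n = refl
consSize-suc +[1+ _ ] n = refl
consSize-suc -[1+ _ ] n = refl

-- Natural summands cannot cancel: over two zero tails a + b is nonzero exactly when a or b is, and
-- over any other tails the constant coefficients do not affect the size of the sum.
consSize-+ : ∀ a b m n → consSize (+ a + + b) (m ⊔ n) ≡ consSize (+ a) m ⊔ consSize (+ b) n
consSize-+ zero    zero    zero    zero    = refl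
consSize-+ zero    (suc _) zero    zero    = refl
consSize-+ (suc _) zero    zero    zero    = refl
consSize-+ (suc _) (suc _) zero    zero    = refl
consSize-+ zero    b       zero    (suc n) = refl
consSize-+ (suc a) b       zero    (suc n) = sym (cong (1 ⊔_) (consSize-suc (+ b) n))
consSize-+ a       zero    (suc m) zero    = trans (consSize-suc _ m) (trans (sym (consSize-suc _ m)) (sym (ℕ.⊔-identityʳ _)))
consSize-+ a       (suc b) (suc m) zero    = trans (consSize-suc _ m) (sym (cong (_⊔ 1) (consSize-suc (+ a) m)))
consSize-+ a       b       (suc m) (suc n) =
  trans (consSize-suc (+ a + + b) (m ⊔ n)) (sym (cong₂ _⊔_ (consSize-suc (+ a) m) (consSize-suc (+ b) n)))

size-+ᵖ : ∀ {p q} → NonNeg p → NonNeg q → size (p +ᵖ q) ≡ size p ⊔ size q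
size-+ᵖ []       qs = refl
size-+ᵖ (_ ∷ _)  [] = sym (ℕ.⊔-identityʳ _)
size-+ᵖ {+ a ∷ p} {+ b ∷ q} (_ ∷ ps) (_ ∷ qs) = begin
  size (+ (a ℕ.+ b) ∷ (p +ᵖ q))                     ≡⟨ size-∷ (+ (a ℕ.+ b)) (p +ᵖ q) ⟩
  consSize (+ (a ℕ.+ b)) (size (p +ᵖ q))            ≡⟨ cong (consSize (+ (a ℕ.+ b))) (size-+ᵖ ps qs) ⟩
  consSize (+ (a ℕ.+ b)) (size p ⊔ size q)          ≡⟨ consSize-+ a b (size p) (size q) ⟩
  consSize (+ a) (size p) ⊔ consSize (+ b) (size q) ≡⟨ cong₂ _⊔_ (size-∷ (+ a) p) (size-∷ (+ b) q) ⟨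
  size (+ a ∷ p) ⊔ size (+ b ∷ q)                   ∎

-- E a = e(a) + 1 for a ≥ 1 and E 0 = 0, which makes the odd recursion hold at 0 as well.
E : ℕ → ℕ
E a = size (B a)

e⇒E : ∀ {a n} → e a ≡ just n → E a ≡ suc n
e⇒E = cong (maybe′ suc 0)

E⇒e : ∀ a {n} → E a ≡ suc n → e a ≡ just n
E⇒e a eq with e a
E⇒e a refl | just _ = refl

E-even : ∀ n → 1 ≤ n → E (2 ℕ.* n) ≡ suc (E n)
E-even n 1≤n with d , eq ← e-defined n 1≤n = begin
  E (2 ℕ.* n)      ≡⟨ cong size (B-even n 1≤n) ⟩
  size (t· B n)    ≡⟨ cong (maybe′ suc 0) (deg-t· (B n) eq) ⟩
  suc (suc d)      ≡⟨ cong suc (e⇒E {n} eq) ⟨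
  suc (E n)        ∎

E-odd : ∀ n → E (suc (2 ℕ.* n)) ≡ E n ⊔ E (suc n)
E-odd zero      = refl
E-odd n@(suc _) = begin
  E (suc (2 ℕ.* n))         ≡⟨ cong E (ℕ.+-comm (2 ℕ.* n) 1) ⟨
  E (2 ℕ.* n ℕ.+ 1)         ≡⟨ cong size (B-odd n z<s) ⟩
  size (B n +ᵖ B (n ℕ.+ 1)) ≡⟨ size-+ᵖ (B-nonNeg n) (B-nonNeg (n ℕ.+ 1)) ⟩
  E n ⊔ E (n ℕ.+ 1)         ≡⟨ cong (λ i → E n ⊔ E i) (ℕ.+-comm n 1) ⟩
  E n ⊔ E (suc n)           ∎

2*suc : ∀ m → suc (suc (2 ℕ.* m)) ≡ 2 ℕ.* suc m
2*suc = solve-∀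

data EvenOdd : ℕ → Set where
  even : ∀ m → EvenOdd (2 ℕ.* m)
  odd  : ∀ m → EvenOdd (suc (2 ℕ.* m))

evenOdd : ∀ n → EvenOdd n
evenOdd zero = even 0
evenOdd (suc n) with evenOdd n
... | even m = odd m
... | odd m  = subst EvenOdd (sym (2*suc m)) (even (suc m))

Close : ℕ → ℕ → Set
Close m n = m ≤ suc n × n ≤ suc m

-- Strong induction by parity. The values at 2m, 2m + 1 and 2m + 2 are E m + 1, max(E m, E (m + 1))
-- and E (m + 1) + 1; the even case uses the bound on E (m + 1) from closeness at m, the odd case
-- the bound on E m.
E-close : ∀ n → Close (E n) (E (suc n))
E-close = <-rec _ go
  where
  go : ∀ n → (∀ {m} → m < n → Close (E m) (E (suc m))) → Close (E n) (E (suc n))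
  go n rec with evenOdd n
  -- `E-even` excludes 0, so this case rests on E 0 = 0 and E 1 = 1.
  ... | even zero = z≤n , s≤s z≤n
  ... | even m@(suc _) with _ , up ← rec (ℕ.m<m+n m z<s)
    rewrite E-even m z<s | E-odd m =
      s≤s (ℕ.m≤m⊔n (E m) _) ,
      ℕ.⊔-lub (ℕ.m≤n⇒m≤1+n (ℕ.n≤1+n _)) (ℕ.m≤n⇒m≤1+n up)
  ... | odd m with down , _ ← rec (s≤s (ℕ.m≤m+n m _))
    rewrite trans (cong E (2*suc m)) (E-even (suc m) z<s) | E-odd m =
      ℕ.⊔-lub (ℕ.m≤n⇒m≤1+n down) (ℕ.m≤n⇒m≤1+n (ℕ.n≤1+n _)) ,
      s≤s (ℕ.m≤n⊔m (E m) _)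

-- Written as iterated doublings so that `E-odd` and the parity view fit directly. Truncation gives
-- `4* 0 ∸1` the value 0, hence the separate treatment of 0 below.
4*_+1 4*_∸1 : ℕ → ℕ
4* a +1 = suc (2 ℕ.* (2 ℕ.* a))
4* a ∸1 = pred (2 ℕ.* (2 ℕ.* a))

4*suc∸1 : ∀ m → 4* suc m ∸1 ≡ suc (2 ℕ.* suc (2 ℕ.* m))
4*suc∸1 m = cong pred (lem m)
  where
  lem : ∀ m → 2 ℕ.* (2 ℕ.* suc m) ≡ suc (suc (2 ℕ.* suc (2 ℕ.* m)))
  lem = solve-∀

-- 4m + 1 sits between 2m and 2m + 1 in the recursion; by closeness the even neighbour 2m attains
-- the maximum.
E-4*+1 : ∀ m → 1 ≤ m → E (4* m +1) ≡ suc (E m)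
E-4*+1 m 1≤m = begin
  E (4* m +1)                       ≡⟨ E-odd (2 ℕ.* m) ⟩
  E (2 ℕ.* m) ⊔ E (suc (2 ℕ.* m))   ≡⟨ cong₂ _⊔_ (E-even m 1≤m) (E-odd m) ⟩
  suc (E m) ⊔ (E m ⊔ E (suc m))     ≡⟨ ℕ.m≥n⇒m⊔n≡m (ℕ.⊔-lub (ℕ.n≤1+n _) (proj₂ (E-close m))) ⟩
  suc (E m)                         ∎

-- The mirror image: 4(m + 1) - 1 comes from 2m + 1 and 2m + 2, and again the even one attains the
-- maximum.
E-4*∸1 : ∀ m → 1 ≤ m → E (4* m ∸1) ≡ suc (E m)
E-4*∸1 (suc m) _ = begin
  E (4* suc m ∸1)                                 ≡⟨ cong E (4*suc∸1 m) ⟩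
  E (suc (2 ℕ.* suc (2 ℕ.* m)))                   ≡⟨ E-odd (suc (2 ℕ.* m)) ⟩
  E (suc (2 ℕ.* m)) ⊔ E (suc (suc (2 ℕ.* m)))     ≡⟨ cong₂ _⊔_ (E-odd m) (trans (cong E (2*suc m)) (E-even (suc m) z<s)) ⟩
  (E m ⊔ E (suc m)) ⊔ suc (E (suc m))             ≡⟨ ℕ.m≤n⇒m⊔n≡n (ℕ.⊔-lub (proj₁ (E-close m)) (ℕ.n≤1+n _)) ⟩
  suc (E (suc m))                                 ∎

-- Fibres of the degree

∈-fibre⁺ : ∀ a n → E a ≡ suc n → a ∈ fibre n
∈-fibre⁺ a@(suc _) n eq = fibre-complete {n} z<s (E⇒e a eq)

∈-fibre⁻ : ∀ a n → a ∈ fibre n → 1 ≤ a × E a ≡ suc n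
∈-fibre⁻ a n a∈ with 1≤a , eq ← fibre-sound {n} a∈ = 1≤a , e⇒E {a} eq

children : List ℕ → List ℕ
children as = map (2 ℕ.*_) as ++ map 4*_+1 as ++ map 4*_∸1 as

∈-children⁺ : ∀ n a → a ∈ fibre (suc n) → a ∈ children (fibre n)
∈-children⁺ n a a∈ with ∈-fibre⁻ a (suc n) a∈ | evenOdd a
... | _ , eq | even m@(suc _) =
  ∈-++⁺ˡ (∈-map⁺ (2 ℕ.*_) (∈-fibre⁺ m n (ℕ.suc-injective (trans (sym (E-even m z<s)) eq))))
... | _ , eq | odd l with evenOdd l
-- Here a = 1, and E 1 = 1 keeps it out of every fibre over a successor.
... | even zero with () ← eq
... | even m@(suc _) = ∈-++⁺ʳ (map (2 ℕ.*_) (fibre n)) (∈-++⁺ˡ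
  (∈-map⁺ 4*_+1 (∈-fibre⁺ m n (ℕ.suc-injective (trans (sym (E-4*+1 m z<s)) eq)))))
-- Since a = 4m + 3 = 4(m + 1) - 1, the parent is `suc m`.
... | odd m = ∈-++⁺ʳ (map (2 ℕ.*_) (fibre n)) (∈-++⁺ʳ (map 4*_+1 (fibre n))
  (subst (_∈ map 4*_∸1 (fibre n)) (4*suc∸1 m)
    (∈-map⁺ 4*_∸1 {xs = fibre n} (∈-fibre⁺ (suc m) n (ℕ.suc-injective
      (trans (sym (E-4*∸1 (suc m) z<s)) (trans (cong E (4*suc∸1 m)) eq)))))))

∈-map-fibre : ∀ n (f : ℕ → ℕ) → (∀ m → 1 ≤ m → E (f m) ≡ suc (E m)) →
  ∀ {a} → a ∈ map f (fibre n) → a ∈ fibre (suc n)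
∈-map-fibre n f step a∈ with m , m∈ , refl ← ∈-map⁻ f a∈ with 1≤m , eq ← ∈-fibre⁻ m n m∈ =
  ∈-fibre⁺ (f m) (suc n) (trans (step m 1≤m) (cong suc eq))

∈-children⁻ : ∀ n a → a ∈ children (fibre n) → a ∈ fibre (suc n)
∈-children⁻ n a a∈ with ∈-++⁻ (map (2 ℕ.*_) (fibre n)) a∈
... | inj₁ a∈₁ = ∈-map-fibre n (2 ℕ.*_) E-even a∈₁
... | inj₂ a∈′ with ∈-++⁻ (map 4*_+1 (fibre n)) a∈′
... | inj₁ a∈₂ = ∈-map-fibre n 4*_+1 E-4*+1 a∈₂
... | inj₂ a∈₃ = ∈-map-fibre n 4*_∸1 E-4*∸1 a∈₃

2*-injective : ∀ {m n} → 2 ℕ.* m ≡ 2 ℕ.* n → m ≡ n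
2*-injective = ℕ.*-cancelˡ-≡ _ _ 2

4*+1-injective : ∀ {m n} → 4* m +1 ≡ 4* n +1 → m ≡ n
4*+1-injective = 2*-injective ∘ 2*-injective ∘ ℕ.suc-injective

-- Truncation does no harm: 0 is the image of 0 alone, because 4(m + 1) - 1 is positive.
4*∸1-injective : ∀ {m n} → 4* m ∸1 ≡ 4* n ∸1 → m ≡ n
4*∸1-injective {zero}  {zero}  _  = refl
4*∸1-injective {zero}  {suc n} eq with () ← trans eq (4*suc∸1 n)
4*∸1-injective {suc m} {zero}  eq with () ← trans (sym eq) (4*suc∸1 m)
4*∸1-injective {suc m} {suc n} eq = cong suc (2*-injective (ℕ.suc-injective (2*-injective
  (ℕ.suc-injective (trans (sym (4*suc∸1 m)) (trans eq (4*suc∸1 n)))))))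

children-unique : ∀ n → Unique (children (fibre n))
children-unique n =
  Unique.++⁺ (Unique.map⁺ 2*-injective F!)
    (Unique.++⁺ (Unique.map⁺ 4*+1-injective F!) (Unique.map⁺ 4*∸1-injective F!) odd-disjoint)
    even-disjoint
  where
  F! = fibre-unique n

  odd-disjoint : Disjoint (map 4*_+1 (fibre n)) (map 4*_∸1 (fibre n))
  odd-disjoint (a∈₂ , a∈₃) with ∈-map⁻ 4*_+1 a∈₂ | ∈-map⁻ 4*_∸1 a∈₃
  ... | l , _ , refl | zero  , m∈ , _  with () ← proj₁ (∈-fibre⁻ 0 n m∈)
  ... | l , _ , refl | suc m , _  , eq =
    -- From 4l + 1 = 4m + 3, removing 1 and halving leaves 2l = 2m + 1.
    ℕ.even≢odd l m (2*-injective (ℕ.suc-injective (trans eq (4*suc∸1 m))))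

  even-disjoint : Disjoint (map (2 ℕ.*_) (fibre n)) (map 4*_+1 (fibre n) ++ map 4*_∸1 (fibre n))
  even-disjoint (a∈₁ , a∈′) with ∈-map⁻ (2 ℕ.*_) a∈₁ | ∈-++⁻ (map 4*_+1 (fibre n)) a∈′
  ... | l , _ , refl | inj₁ a∈₂ with m , _ , eq ← ∈-map⁻ 4*_+1 a∈₂ = ℕ.even≢odd l (2 ℕ.* m) eq
  ... | l , _ , refl | inj₂ a∈₃ with ∈-map⁻ 4*_∸1 a∈₃
  -- The truncated value 0 is even, so this case is excluded by positivity of the fibre and not by
  -- parity.
  ... | zero  , m∈ , _  with () ← proj₁ (∈-fibre⁻ 0 n m∈)
  ... | suc m , _  , eq = ℕ.even≢odd l (suc (2 ℕ.* m)) (trans eq (4*suc∸1 m))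

-- Duplicate-free lists with the same members are equal as bags, hence permutations of each other,
-- and sums are invariant under permutation.
fibre-suc : ∀ n → fibre (suc n) ↭ children (fibre n)
fibre-suc n = ∼bag⇒↭ (unique∧set⇒bag (fibre-unique (suc n)) (children-unique n) (λ {a} → mk⇔ (∈-children⁺ n a) (∈-children⁻ n a)))

-- Power sums

-- Integer-valued because the expansion of (4a - 1)^k has signs; on `fibre n` it is `G k n` by
-- definition.
powerSum : ℕ → List ℕ → ℤ
powerSum k as = + sum (map (ℕ._^ k) as)

powerSum-++ : ∀ k as bs → powerSum k (as ++ bs) ≡ powerSum k as + powerSum k bs
powerSum-++ k as bs = cong +_ (trans (cong sum (map-++ (ℕ._^ k) as bs)) (sum-++ (map (ℕ._^ k) as) _))

pos-^ : ∀ m k → + (m ℕ.^ k) ≡ (+ m) ^ k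
pos-^ m zero    = refl
pos-^ m (suc k) = trans (ℤ.pos-* m (m ℕ.^ k)) (cong (+ m *_) (pos-^ m k))

powerSum-∷ : ∀ k a as → powerSum k (a ∷ as) ≡ (+ a) ^ k + powerSum k as
powerSum-∷ k a as = cong (_+ powerSum k as) (pos-^ a k)

module _ where
  open Exp ℤ.+-*-commutativeSemiring using () renaming (_^_ to _^′_)
  open Mult ℤ.+-*-semiring using () renaming (_×_ to _×′_)

  -- The binomial theorem speaks of the generic power and multiple of a commutative semiring; this
  -- lemma and the next translate them to integer operations.
  ^≡^′ : ∀ i k → i ^ k ≡ i ^′ k
  ^≡^′ i zero    = refl
  ^≡^′ i (suc k) = cong (i *_) (^≡^′ i k)

  ×′≡* : ∀ m i → m ×′ i ≡ + m * i
  ×′≡* zero    i = refl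
  ×′≡* (suc m) i = begin
    i + m ×′ i         ≡⟨ cong (λ s → i + s) (×′≡* m i) ⟩
    i + + m * i        ≡⟨ ℤ.suc-* (+ m) i ⟨
    + suc m * i        ∎

  ^-distrib-* : ∀ i j k → (i * j) ^ k ≡ i ^ k * j ^ k
  ^-distrib-* i j k = begin
    (i * j) ^ k        ≡⟨ ^≡^′ (i * j) k ⟩
    (i * j) ^′ k       ≡⟨ Exp.^-distrib-* ℤ.+-*-commutativeSemiring i j k ⟩
    i ^′ k * j ^′ k    ≡⟨ cong₂ _*_ (^≡^′ i k) (^≡^′ j k) ⟨
    i ^ k * j ^ k      ∎

  [i+1]^k : ∀ i k → (i + 1ℤ) ^ k ≡ ∑[ j ≤ k ] (+ (k C toℕ j) * i ^ toℕ j)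
  [i+1]^k i k = begin
    (i + 1ℤ) ^ k         ≡⟨ ^≡^′ (i + 1ℤ) k ⟩
    (i + 1ℤ) ^′ k        ≡⟨ Binomial.theorem ℤ.+-*-commutativeSemiring k i 1ℤ ⟩
    _                    ≡⟨ sum-cong-≗ {suc k} term ⟩
    ∑[ j ≤ k ] (+ (k C toℕ j) * i ^ toℕ j) ∎
    where
    term : ∀ (j : Fin (suc k)) →
      (k C toℕ j) ×′ (i ^′ toℕ j * 1ℤ ^′ (k ℕ.∸ toℕ j)) ≡ + (k C toℕ j) * i ^ toℕ j
    term j = trans (×′≡* (k C toℕ j) _) (cong (+ (k C toℕ j) *_) (begin
      i ^′ toℕ j * 1ℤ ^′ (k ℕ.∸ toℕ j) ≡⟨ cong₂ _*_ (^≡^′ i (toℕ j)) (^≡^′ 1ℤ (k ℕ.∸ toℕ j)) ⟨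
      i ^ toℕ j * 1ℤ ^ (k ℕ.∸ toℕ j)   ≡⟨ cong (i ^ toℕ j *_) (ℤ.^-zeroˡ (k ℕ.∸ toℕ j)) ⟩
      i ^ toℕ j * 1ℤ                   ≡⟨ ℤ.*-identityʳ _ ⟩
      i ^ toℕ j                        ∎))

-- The coefficient of a^j in (4a + 1)^k + (4a - 1)^k.
coeff : ℕ → ℕ → ℤ
coeff k j = + (k C j) * ((+ 4) ^ j + (- (+ 1)) ^ k * (- (+ 4)) ^ j)

-- The reciprocal of the root of the denominator in the theorem.
pole : ℕ → ℤ
pole k = (+ 2) ^ k * ((+ 2) ^ suc k + + 1)

∑-+ : ∀ {n} (f g : Fin n → ℤ) → (∑[ i < n ] (f i + g i)) ≡ (∑[ i < n ] f i) + (∑[ i < n ] g i)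
∑-+ = ∑-distrib-+ ℤ.+-0-commutativeMonoid

-- (4a − 1)ᵏ is expanded as (−1)ᵏ (1 − 4a)ᵏ, which is where (−1)ᵏ (−4)ʲ comes from.
^-4*±1 : ∀ k a → 1 ≤ a →
  (+ (4* a +1)) ^ k + (+ (4* a ∸1)) ^ k ≡ ∑[ j ≤ k ] (coeff k (toℕ j) * (+ a) ^ toℕ j)
^-4*±1 k a@(suc m) _ = begin
  (+ (4* a +1)) ^ k + (+ (4* a ∸1)) ^ k
    ≡⟨ cong₂ _+_ plus minus ⟩
  (∑[ j ≤ k ] p j) + (- 1ℤ) ^ k * (∑[ j ≤ k ] q j)
    ≡⟨ cong (λ s → (∑[ j ≤ k ] p j) + s) (*-distribˡ-sum ((- 1ℤ) ^ k) q) ⟩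
  (∑[ j ≤ k ] p j) + (∑[ j ≤ k ] ((- 1ℤ) ^ k * q j))
    ≡⟨ ∑-+ p (λ j → (- 1ℤ) ^ k * q j) ⟨
  (∑[ j ≤ k ] (p j + (- 1ℤ) ^ k * q j))
    ≡⟨ sum-cong-≗ {suc k} term ⟩
  (∑[ j ≤ k ] (coeff k (toℕ j) * (+ a) ^ toℕ j)) ∎
  where
  bin p q : Fin (suc k) → ℤ
  bin j = + (k C toℕ j)
  p j   = bin j * (+ 4 * + a) ^ toℕ j
  q j   = bin j * (- (+ 4) * + a) ^ toℕ j

  4*a : + (2 ℕ.* (2 ℕ.* a)) ≡ + 4 * + a
  4*a = trans (cong +_ (lem a)) (ℤ.pos-* 4 a)
    where
    lem : ∀ a → 2 ℕ.* (2 ℕ.* a) ≡ 4 ℕ.* a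
    lem = solve-∀

  plus : (+ (4* a +1)) ^ k ≡ ∑[ j ≤ k ] p j
  plus = trans (cong (_^ k) (trans (ℤ.+-comm 1ℤ (+ (2 ℕ.* (2 ℕ.* a)))) (cong (_+ 1ℤ) 4*a))) ([i+1]^k (+ 4 * + a) k)

  neg : ∀ i → - 1ℤ + (+ 4 * i) ≡ - 1ℤ * (- (+ 4) * i + 1ℤ)
  neg = ℤ-Solver.solve-∀

  minus : (+ (4* a ∸1)) ^ k ≡ (- 1ℤ) ^ k * (∑[ j ≤ k ] q j)
  minus = begin
    -- As `a` is a successor, -1 plus `+ (2 * (2 * a))` reduces to `+ (4* a ∸1)`, with no
    -- truncation.
    (+ (4* a ∸1)) ^ k                           ≡⟨ cong (_^ k) (trans (cong (λ s → - 1ℤ + s) 4*a) (neg (+ a))) ⟩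
    (- 1ℤ * (- (+ 4) * + a + 1ℤ)) ^ k           ≡⟨ ^-distrib-* (- 1ℤ) (- (+ 4) * + a + 1ℤ) k ⟩
    (- 1ℤ) ^ k * (- (+ 4) * + a + 1ℤ) ^ k       ≡⟨ cong ((- 1ℤ) ^ k *_) ([i+1]^k (- (+ 4) * + a) k) ⟩
    (- 1ℤ) ^ k * (∑[ j ≤ k ] q j) ∎

  collect : ∀ b s p q u → b * (p * u) + s * (b * (q * u)) ≡ b * (p + s * q) * u
  collect = ℤ-Solver.solve-∀

  term : ∀ (j : Fin (suc k)) →
    p j + (- 1ℤ) ^ k * q j ≡ coeff k (toℕ j) * (+ a) ^ toℕ j
  term j = trans
    (cong₂ (λ u v → bin j * u + (- 1ℤ) ^ k * (bin j * v))
      (^-distrib-* (+ 4) (+ a) (toℕ j)) (^-distrib-* (- (+ 4)) (+ a) (toℕ j)))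
    (collect (bin j) ((- 1ℤ) ^ k) ((+ 4) ^ toℕ j) ((- (+ 4)) ^ toℕ j) ((+ a) ^ toℕ j))

-- The two odd families are summed together, entry by entry. Positivity matters: at a = 0 truncation
-- would put 0 in place of -1.
powerSum-odd : ∀ k {as} → All (1 ≤_) as →
  powerSum k (map 4*_+1 as) + powerSum k (map 4*_∸1 as) ≡ ∑[ j ≤ k ] (coeff k (toℕ j) * powerSum (toℕ j) as)
powerSum-odd k []       = sym (trans (sum-cong-≗ {suc k} (λ j → ℤ.*-zeroʳ (coeff k (toℕ j)))) (sum-replicate-zero (suc k)))
powerSum-odd k {a ∷ as} (1≤a ∷ 1≤as) = begin
  powerSum k (4* a +1 ∷ map 4*_+1 as) + powerSum k (4* a ∸1 ∷ map 4*_∸1 as)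
    ≡⟨ cong₂ _+_ (powerSum-∷ k (4* a +1) (map 4*_+1 as)) (powerSum-∷ k (4* a ∸1) (map 4*_∸1 as)) ⟩
  ((+ (4* a +1)) ^ k + powerSum k (map 4*_+1 as)) + ((+ (4* a ∸1)) ^ k + powerSum k (map 4*_∸1 as))
    ≡⟨ interchange ((+ (4* a +1)) ^ k) _ ((+ (4* a ∸1)) ^ k) _ ⟩
  ((+ (4* a +1)) ^ k + (+ (4* a ∸1)) ^ k) + (powerSum k (map 4*_+1 as) + powerSum k (map 4*_∸1 as))
    ≡⟨ cong₂ _+_ (^-4*±1 k a 1≤a) (powerSum-odd k 1≤as) ⟩
  (∑[ j ≤ k ] p j) + (∑[ j ≤ k ] q j)
    ≡⟨ ∑-+ p q ⟨
  (∑[ j ≤ k ] (p j + q j))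
    ≡⟨ sum-cong-≗ {suc k} term ⟩
  (∑[ j ≤ k ] (coeff k (toℕ j) * powerSum (toℕ j) (a ∷ as))) ∎
  where
  p q : Fin (suc k) → ℤ
  p j = coeff k (toℕ j) * (+ a) ^ toℕ j
  q j = coeff k (toℕ j) * powerSum (toℕ j) as

  term : ∀ j → p j + q j ≡ coeff k (toℕ j) * powerSum (toℕ j) (a ∷ as)
  term j = begin
    p j + q j                                               ≡⟨ ℤ.*-distribˡ-+ (coeff k (toℕ j)) ((+ a) ^ toℕ j) (powerSum (toℕ j) as) ⟨
    coeff k (toℕ j) * ((+ a) ^ toℕ j + powerSum (toℕ j) as) ≡⟨ cong (coeff k (toℕ j) *_) (powerSum-∷ (toℕ j) a as) ⟨
    coeff k (toℕ j) * powerSum (toℕ j) (a ∷ as)             ∎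

  interchange : ∀ p q r s → (p + q) + (r + s) ≡ (p + r) + (q + s)
  interchange = ℤ-Solver.solve-∀

powerSum-even : ∀ k as → powerSum k (map (2 ℕ.*_) as) ≡ (+ 2) ^ k * powerSum k as
powerSum-even k []       = sym (ℤ.*-zeroʳ ((+ 2) ^ k))
powerSum-even k (a ∷ as) = begin
  powerSum k (2 ℕ.* a ∷ map (2 ℕ.*_) as)                ≡⟨ powerSum-∷ k (2 ℕ.* a) (map (2 ℕ.*_) as) ⟩
  (+ (2 ℕ.* a)) ^ k + powerSum k (map (2 ℕ.*_) as)      ≡⟨ cong₂ _+_ (trans (cong (_^ k) (ℤ.pos-* 2 a)) (^-distrib-* (+ 2) (+ a) k)) (powerSum-even k as) ⟩
  (+ 2) ^ k * (+ a) ^ k + (+ 2) ^ k * powerSum k as     ≡⟨ ℤ.*-distribˡ-+ ((+ 2) ^ k) _ _ ⟨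
  (+ 2) ^ k * ((+ a) ^ k + powerSum k as)               ≡⟨ cong ((+ 2) ^ k *_) (powerSum-∷ k a as) ⟨
  (+ 2) ^ k * powerSum k (a ∷ as)                       ∎

∑-last : ∀ n (f : ℕ → ℤ) → (∑[ i ≤ n ] f (toℕ i)) ≡ (∑[ i < n ] f (toℕ i)) + f n
∑-last n f = trans (sum-init-last {n} (f ∘ toℕ))
  (cong₂ _+_ (sum-cong-≗ {n} (λ i → cong f (toℕ-inject₁ i))) (cong f (toℕ-fromℕ n)))

-- At j = k the signs cancel, as (-1)(-4) = 4, so the total is 2^k + 2 · 4^k with 4^k = 2^k · 2^k.
pole≡ : ∀ k → (+ 2) ^ k + coeff k k ≡ pole k
pole≡ k = begin
  (+ 2) ^ k + coeff k k
    ≡⟨ cong₂ (λ b s → (+ 2) ^ k + + b * ((+ 4) ^ k + s)) (nCn≡1 k) (sym (^-distrib-* (- 1ℤ) (- (+ 4)) k)) ⟩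
  (+ 2) ^ k + + 1 * ((+ 4) ^ k + (+ 4) ^ k)
    ≡⟨ cong (λ s → (+ 2) ^ k + + 1 * (s + s)) (^-distrib-* (+ 2) (+ 2) k) ⟩
  (+ 2) ^ k + + 1 * ((+ 2) ^ k * (+ 2) ^ k + (+ 2) ^ k * (+ 2) ^ k)
    ≡⟨ lem ((+ 2) ^ k) ⟩
  pole k ∎
  where
  lem : ∀ p → p + + 1 * (p * p + p * p) ≡ p * (+ 2 * p + + 1)
  lem = ℤ-Solver.solve-∀

-- The top term j = k of the binomial sum involves `G k` itself and joins the 2^k from the even
-- children.
G-suc : ∀ k n → G k (suc n) ≡ pole k * G k n + (∑[ j < k ] (coeff k (toℕ j) * G (toℕ j) n))
G-suc k n = begin
  G k (suc n)
    ≡⟨ cong +_ (sum-↭ (map⁺ (ℕ._^ k) (fibre-suc n))) ⟩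
  powerSum k (children F)
    ≡⟨ trans (powerSum-++ k (map (2 ℕ.*_) F) _) (cong (λ s → powerSum k (map (2 ℕ.*_) F) + s) (powerSum-++ k (map 4*_+1 F) _)) ⟩
  powerSum k (map (2 ℕ.*_) F) + (powerSum k (map 4*_+1 F) + powerSum k (map 4*_∸1 F))
    ≡⟨ cong₂ _+_ (powerSum-even k F) (powerSum-odd k (tabulate (λ {a} → proj₁ ∘ ∈-fibre⁻ a n))) ⟩
  (+ 2) ^ k * G k n + (∑[ j ≤ k ] (coeff k (toℕ j) * G (toℕ j) n))
    ≡⟨ cong (λ s → (+ 2) ^ k * G k n + s) (∑-last k (λ j → coeff k j * G j n)) ⟩
  (+ 2) ^ k * G k n + (lower + coeff k k * G k n)
    ≡⟨ lem ((+ 2) ^ k) (coeff k k) (G k n) lower ⟩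
  ((+ 2) ^ k + coeff k k) * G k n + lower
    ≡⟨ cong (λ c → c * G k n + lower) (pole≡ k) ⟩
  pole k * G k n + lower ∎
  where
  F = fibre n
  lower = ∑[ j < k ] (coeff k (toℕ j) * G (toℕ j) n)
  lem : ∀ p c g s → p * g + (s + c * g) ≡ (p + c) * g + s
  lem = ℤ-Solver.solve-∀

-- The fibre over 0 evaluates to `1 ∷ []`, which leaves 1^k + 0.
G-zero : ∀ k → G k 0 ≡ 1ℤ
G-zero k = cong +_ (trans (ℕ.+-identityʳ (1 ℕ.^ k)) (ℕ.^-zeroˡ k))

-- Power series with denominator 1 − c x

∑-zero : ∀ n (f : Fin n → ℤ) → (∀ i → f i ≡ 0ℤ) → (∑[ i < n ] f i) ≡ 0ℤ
∑-zero n f f≡0 = trans (sum-cong-≗ {n} f≡0) (sum-replicate-zero n)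

constˢ-* : ∀ c f → constˢ c *ˢ f ≈ˢ λ n → c * f n
constˢ-* c f n = trans (cong (λ s → c * f n + s) (∑-zero n _ (λ _ → refl))) (ℤ.+-identityʳ _)

x-*-suc : ∀ f n → (x *ˢ f) (suc n) ≡ f n
x-*-suc f n = begin
  0ℤ + (1ℤ * f n + (∑[ i < n ] (0ℤ * f (n ℕ.∸ suc (toℕ i)))))
    ≡⟨ cong (λ s → 0ℤ + (1ℤ * f n + s)) (∑-zero n _ (λ _ → refl)) ⟩
  0ℤ + (1ℤ * f n + 0ℤ)
    ≡⟨ trans (ℤ.+-identityˡ _) (trans (ℤ.+-identityʳ _) (ℤ.*-identityˡ _)) ⟩
  f n ∎

module _ (c : ℤ) where

  den : FPS
  den = 1ˢ -ˢ constˢ c *ˢ x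

  den-suc : ∀ n → den (suc n) ≡ - (c * x (suc n))
  den-suc n = trans (ℤ.+-identityˡ _) (cong -_ (constˢ-* c x (suc n)))

  -- The coefficient of x^(n + 1) in `den` times its inverse is 0, and beyond 1 and -c all
  -- coefficients of `den` vanish. Thus the inverse is the geometric series.
  inverse-den-suc : ∀ n → inverse den (suc n) ≡ c * inverse den n
  inverse-den-suc n = begin
    inverse den (suc n)
      ≡⟨ move c (inverse den (suc n)) (inverse den n) ⟩
    (1ℤ * inverse den (suc n) + (- c * inverse den n)) + c * inverse den n
      ≡⟨ cong (_+ c * inverse den n) (trans (cong₂ _+_ (cong (_* inverse den (suc n)) (sym (1-cx-constantTerm c))) (sym tail)) (inverse-correct den (1-cx-constantTerm c) (suc n))) ⟩
    0ℤ + c * inverse den n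
      ≡⟨ ℤ.+-identityˡ _ ⟩
    c * inverse den n ∎
    where
    move : ∀ c i s → i ≡ (1ℤ * i + - c * s) + c * s
    move = ℤ-Solver.solve-∀
    tail : (∑[ i ≤ n ] (den (suc (toℕ i)) * inverse den (n ℕ.∸ toℕ i))) ≡ - c * inverse den n
    tail = begin
      den 1 * inverse den n + (∑[ i < n ] (den (suc (suc (toℕ i))) * inverse den (n ℕ.∸ suc (toℕ i))))
        ≡⟨ cong₂ _+_ (cong (_* inverse den n) (trans (den-suc 0) (cong -_ (ℤ.*-identityʳ c))))
             (∑-zero n _ (λ i → cong (_* inverse den (n ℕ.∸ suc (toℕ i))) (trans (den-suc (suc (toℕ i))) (cong -_ (ℤ.*-zeroʳ c))))) ⟩
      - c * inverse den n + 0ℤ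
        ≡⟨ ℤ.+-identityʳ _ ⟩
      - c * inverse den n ∎

  /-den-zero : ∀ f → (f *ˢ inverse den) 0 ≡ f 0
  /-den-zero f = trans (ℤ.+-identityʳ _) (ℤ.*-identityʳ (f 0))

  -- Every term of the convolution with index at most n gains a factor c from the geometric series;
  -- the remaining one is f (n + 1) times the constant term 1.
  /-den-suc : ∀ f n → (f *ˢ inverse den) (suc n) ≡ c * (f *ˢ inverse den) n + f (suc n)
  /-den-suc f n = begin
    (f *ˢ inverse den) (suc n)
      ≡⟨ ∑-last (suc n) (λ i → f i * inverse den (suc n ℕ.∸ i)) ⟩
    (∑[ i ≤ n ] (f (toℕ i) * inverse den (suc n ℕ.∸ toℕ i))) + f (suc n) * inverse den (n ℕ.∸ n)
      ≡⟨ cong₂ _+_ (sum-cong-≗ {suc n} term) (trans (cong (λ i → f (suc n) * inverse den i) (ℕ.n∸n≡0 n)) (ℤ.*-identityʳ _)) ⟩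
    (∑[ i ≤ n ] (c * (f (toℕ i) * inverse den (n ℕ.∸ toℕ i)))) + f (suc n)
      ≡⟨ cong (_+ f (suc n)) (*-distribˡ-sum {suc n} c (λ i → f (toℕ i) * inverse den (n ℕ.∸ toℕ i))) ⟨
    c * (f *ˢ inverse den) n + f (suc n) ∎
    where
    swap : ∀ a b i → a * (b * i) ≡ b * (a * i)
    swap = ℤ-Solver.solve-∀
    term : ∀ (i : Fin (suc n)) →
      f (toℕ i) * inverse den (suc n ℕ.∸ toℕ i) ≡ c * (f (toℕ i) * inverse den (n ℕ.∸ toℕ i))
    term i = trans
      -- The bound `toℕ i ≤ n` turns `suc n ∸ toℕ i` into a successor.
      (cong (f (toℕ i) *_) (trans (cong (inverse den) (ℕ.+-∸-assoc 1 (toℕ≤pred[n] i))) (inverse-den-suc (n ℕ.∸ toℕ i))))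
      (swap (f (toℕ i)) c _)

  -- A first-order recurrence with given initial value has one solution, so a quotient by 1 - c x is
  -- recognised by its coefficients alone.
  /-den-unique : ∀ f g → g 0 ≡ f 0 → (∀ n → g (suc n) ≡ c * g n + f (suc n)) → g ≈ˢ f *ˢ inverse den
  /-den-unique f g g₀ gₛ zero    = trans g₀ (sym (/-den-zero f))
  /-den-unique f g g₀ gₛ (suc n) = begin
    g (suc n)                              ≡⟨ gₛ n ⟩
    c * g n + f (suc n)                    ≡⟨ cong (λ h → c * h + f (suc n)) (/-den-unique f g g₀ gₛ n) ⟩
    c * (f *ˢ inverse den) n + f (suc n)   ≡⟨ /-den-suc f n ⟨
    (f *ˢ inverse den) (suc n)             ∎

mainTheorem8 : (k : ℕ) →
    G k ≈ˢ
    (1ˢ +ˢ x *ˢ (∑ˢ[ j < k ] (constˢ (+ (k C toℕ j) * ((+ 4) ^ toℕ j + (- (+ 1)) ^ k * (- (+ 4)) ^ toℕ j)) *ˢ G (toℕ j))))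
    /ˢ (1ˢ -ˢ constˢ ((+ 2) ^ k * ((+ 2) ^ suc k + + 1)) *ˢ x)
    ∵ 1-cx-constantTerm ((+ 2) ^ k * ((+ 2) ^ suc k + + 1))
-- The numerator has constant term 1 by reduction, so `G-zero` supplies the initial value as it
-- stands.
mainTheorem8 k = /-den-unique (pole k) (1ˢ +ˢ x *ˢ lower) (G k) (G-zero k) step
  where
  lower : FPS
  lower = ∑ˢ[ j < k ] (constˢ (coeff k (toℕ j)) *ˢ G (toℕ j))

  step : ∀ n → G k (suc n) ≡ pole k * G k n + (1ˢ +ˢ x *ˢ lower) (suc n)
  step n = trans (G-suc k n) (cong (λ s → pole k * G k n + s) (begin
    (∑[ j < k ] (coeff k (toℕ j) * G (toℕ j) n)) ≡⟨ sum-cong-≗ {k} (λ j → constˢ-* (coeff k (toℕ j)) (G (toℕ j)) n) ⟨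
    lower n                                      ≡⟨ x-*-suc lower n ⟨
    (x *ˢ lower) (suc n)                         ≡⟨ ℤ.+-identityˡ _ ⟨
    (1ˢ +ˢ x *ˢ lower) (suc n)                   ∎))
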